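{- Let $(W,S)$ be a Coxeter system, let $u,w\in W$ with $u<w$ in Bruhat order, and let $n$ be a nonnegative integer. If $n<a(u,w)$ or $n>\ell(u,w)$, then $[(q-1)^n](R_{uw})=0$. Otherwise (i.e. $a(u,w)\le n\le \ell(u,w)$), $[(q-1)^n](R_{uw})>0$. In particular, $(q-1)^{a(u,w)}$ is the largest power of $q-1$ dividing $R_{uw}(q)$, and $R_{uw}(q)\ge_{q-1}0$ for all $u,w\in W$.
   Context: $(W,S)$ is a Coxeter system with length function $\ell$ and set of reflections $T=\bigcup_{w\in W}w^{ -1}Sw$. Write $u\to w$ if $w=ut$ for some $t\in T$ and $\ell(u)<\ell(w)$; Bruhat order $u\le w$ means there is a chain $u\to v_1\to\cdots\to v_n=w$ (the directed graph on $W$ with these edges is the Bruhat graph). Set $\ell(u,w)=\ell(w)-\ell(u)$. For $u\le w$, the absolute length $a(u,w)$ is the minimum $n\ge0$ such that there is a directed path $u\to v_1\to\cdots\to v_n=w$. The $R$-polynomials $R_{uw}(q)\in\mathbb{Z}[q]$ are the unique family with $R_{uw}=0$ if $u\not\le w$, $R_{ww}=1$, and, for $s\in S$ with $ws<w$: $R_{uw}=R_{us,ws}$ if $us<u$, and $R_{uw}=qR_{us,ws}+(q-1)R_{u,ws}$ if $u<us$. For a real polynomial $f$, $[(q-1)^n](f):=f^{(n)}(1)/n!$ is the coefficient of $(q-1)^n$ in the expansion of $f$ in powers of $q-1$, and $f\le_{q-1}g$ means $[(q-1)^n](f)\le[(q-1)^n](g)$ for all $n\ge0$. -}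

module Defs where

open import Data.Nat using (ℕ; zero; suc; _*_; _≤_; _<_)
open import Data.Nat.Combinatorics using (_C_)
open import Data.Integer as ℤ using (ℤ; +_; 0ℤ; 1ℤ)
open import Data.List using (List; []; _∷_; _++_; [_]; length; reverse; map)
open import Data.Product using (Σ; _×_; ∃; ∃-syntax)
open import Relation.Binary.PropositionalEquality using (_≡_)
open import Relation.Nullary using (¬_)

-- Integer polynomials in q, as coefficient lists (constant term first).

Poly : Set
Poly = List ℤ

coeff : Poly → ℕ → ℤ
coeff []      _       = 0ℤ
coeff (c ∷ f) zero    = c
coeff (c ∷ f) (suc k) = coeff f k

-- equality of polynomials (coefficientwise; ignores trailing zeros)
_≈ₚ_ : Poly → Poly → Set
f ≈ₚ g = ∀ k → coeff f k ≡ coeff g k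

0ₚ 1ₚ : Poly
0ₚ = []
1ₚ = 1ℤ ∷ []

_⊕_ : Poly → Poly → Poly
[]      ⊕ g       = g
(a ∷ f) ⊕ []      = a ∷ f
(a ∷ f) ⊕ (b ∷ g) = (a ℤ.+ b) ∷ (f ⊕ g)

⊖_ : Poly → Poly
⊖ f = map ℤ.-_ f

q·_ : Poly → Poly
q· f = 0ℤ ∷ f

q-1·_ : Poly → Poly
q-1· f = (q· f) ⊕ (⊖ f)

q-1^_·_ : ℕ → Poly → Poly
q-1^ zero  · f = f
q-1^ suc k · f = q-1· (q-1^ k · f)

-- [(q-1)^n](f) = f^(n)(1)/n! = Σ_k (k choose n) f_k
coefQ1 : ℕ → Poly → ℤ
coefQ1 n f = go 0 f
  where
  go : ℕ → Poly → ℤ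
  go k []       = 0ℤ
  go k (c ∷ cs) = ((+ (k C n)) ℤ.* c) ℤ.+ go (suc k) cs

Q1Divides : ℕ → Poly → Set
Q1Divides k f = Σ Poly λ g → f ≈ₚ (q-1^ k · g)

NonnegQ1 : Poly → Set
NonnegQ1 f = ∀ n → 0ℤ ℤ.≤ coefQ1 n f

-- Coxeter matrices (0 encodes ∞)

IsCoxeterMatrix : {I : Set} → (I → I → ℕ) → Set
IsCoxeterMatrix {I} m =
  (∀ s → m s s ≡ 1) × (∀ s t → m s t ≡ m t s) × (∀ s t → m s t ≡ 1 → s ≡ t)

-- The Coxeter system (W,S) presented by a Coxeter matrix m:
-- W = words in I modulo the congruence generated by (st)^{m(s,t)} = 1
-- (m(s,t) ≠ 0). Since m(s,s)=1 every generator is an involution, so the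
-- monoid quotient is the group ⟨S | (st)^{m(s,t)}⟩.

module Coxeter {I : Set} (m : I → I → ℕ) where

  Word : Set
  Word = List I

  alt : I → I → ℕ → Word
  alt s t zero    = []
  alt s t (suc k) = s ∷ alt t s k

  infix 4 _∼_
  data _∼_ : Word → Word → Set where
    ∼-refl  : ∀ {x} → x ∼ x
    ∼-sym   : ∀ {x y} → x ∼ y → y ∼ x
    ∼-trans : ∀ {x y z} → x ∼ y → y ∼ z → x ∼ z
    ∼-ctx   : ∀ a b {x y} → x ∼ y → (a ++ x ++ b) ∼ (a ++ y ++ b)
    ∼-rel   : ∀ s t → ¬ (m s t ≡ 0) → alt s t (2 * m s t) ∼ []

  IsLength : Word → ℕ → Set
  IsLength x n = (Σ Word λ y → (y ∼ x) × (length y ≡ n))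
               × (∀ y → y ∼ x → n ≤ length y)

  Shorter : Word → Word → Set
  Shorter x y = ∃[ lx ] ∃[ ly ] (IsLength x lx × IsLength y ly × lx < ly)

  -- t ∈ T = ⋃ x⁻¹ S x  (x⁻¹ is the reversed word)
  IsReflection : Word → Set
  IsReflection t = Σ Word λ x → Σ I λ s → t ∼ (reverse x ++ s ∷ x)

  infix 4 _⟶_
  _⟶_ : Word → Word → Set
  u ⟶ w = Σ Word λ t → IsReflection t × (w ∼ (u ++ t)) × Shorter u w

  data Path : Word → Word → ℕ → Set where
    here : ∀ {u w} → u ∼ w → Path u w 0
    step : ∀ {u v w n} → u ⟶ v → Path v w n → Path u w (suc n)

  _≤B_ : Word → Word → Set
  u ≤B w = ∃[ n ] Path u w n

  _<B_ : Word → Word → Set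
  u <B w = (u ≤B w) × ¬ (u ∼ w)

  IsAbsLength : Word → Word → ℕ → Set
  IsAbsLength u w k = Path u w k × (∀ j → Path u w j → k ≤ j)

  record IsRFamily (R : Word → Word → Poly) : Set where
    field
      resp  : ∀ {u u′ w w′} → u ∼ u′ → w ∼ w′ → R u w ≈ₚ R u′ w′
      vanish : ∀ u w → ¬ (u ≤B w) → R u w ≈ₚ 0ₚ
      diag  : ∀ w → R w w ≈ₚ 1ₚ
      rec-down : ∀ u w s → Shorter (w ++ [ s ]) w → Shorter (u ++ [ s ]) u →
                 R u w ≈ₚ R (u ++ [ s ]) (w ++ [ s ])
      rec-up   : ∀ u w s → Shorter (w ++ [ s ]) w → Shorter u (u ++ [ s ]) →
                 R u w ≈ₚ ((q· R (u ++ [ s ]) (w ++ [ s ])) ⊕ (q-1· R u (w ++ [ s ])))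

{-# OPTIONS --safe #-}

-- Put p = q - 1, so that for ws < w and u < us the recursion reads R_uw = (p + 1) R_{us,ws} + p R_{u,ws}:
-- no cancellation can occur, and by induction on ℓ(w) the support of R_uw in powers of p is computed
-- exactly. It is the interval [a(u,w), ℓ(u,w)] because a(u,w) obeys the matching recursion:
-- a(u,w) = a(us,ws) if us < u, and a(u,w) = min (a(us,ws), a(u,ws) + 1) if u < us (a = ∞ if not ≤).
-- The latter holds because x → v implies xs → vs unless v = xs, which is read off from the reflection
-- cocycle (the parity with which a reflection occurs among those of a word); the same cocycle gives
-- strong exchange, i.e. it decides whether multiplying by a reflection goes up or down.
--
-- Equality in W, lengths and paths are not decidable a priori. All conclusions reduce to
-- equalities and inequalities of integers, which are stable under double negation, so the case
-- distinctions are made in the double-negation monad.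
module Submission where

open import Defs
open import Data.Bool using (Bool; true; false; not; _xor_)
open import Data.Bool.Properties using (not-distribˡ-xor; xor-same; xor-inverseʳ) renaming (_≟_ to _≟ᵇ_)
open import Data.Integer as ℤ using (ℤ; +_; 0ℤ; 1ℤ) renaming (_<_ to _<ℤ_)
import Data.Integer.Properties as ℤ
open import Data.Integer.Tactic.RingSolver using (solve-∀)
open import Data.List using (List; _∷_; []; _++_; [_]; length; reverse; initLast; _∷ʳ′_)
open import Data.List.Properties using (++-assoc; ++-identityʳ; unfold-reverse; reverse-++; reverse-involutive; length-++)
open import Data.Nat using (ℕ; zero; suc; _+_; _*_; _∸_; _≤_; _<_; s≤s; s≤s⁻¹; z≤n; _≤?_)
open import Data.Nat.Combinatorics using (_C_; nCk+nC[k+1]≡[n+1]C[k+1])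
open import Data.Nat.Properties as ℕ using (≤-trans; ≤-refl; ≤-antisym; ≤-reflexive; <⇒≤; ≮⇒≥; ≰⇒>; +-suc; +-identityʳ; +-comm)
open import Data.Product using (∃; ∃-syntax; _×_; _,_; proj₁; proj₂)
open import Data.Sum using (_⊎_; inj₁; inj₂)
open import Effect.Monad using (RawMonad)
open import Function using (_∘_)
open import Level using (0ℓ)
open import Relation.Binary.Bundles using (Setoid)
open import Relation.Binary.PropositionalEquality using (_≡_; refl; sym; trans; cong; cong₂; subst; subst₂; module ≡-Reasoning)
import Relation.Binary.Reasoning.Setoid as SetoidReasoning
open import Relation.Nullary using (¬_; yes; no)
open import Relation.Nullary.Decidable using (decidable-stable; ¬¬-excluded-middle)
open import Relation.Nullary.Negation using (¬¬-Monad; ¬¬-map; contradiction)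

-- Expansion of polynomials in powers of q - 1.

-- The worker of coefQ1 is local to its where block; unification names it.
mutual
  worker : ℕ → Poly → ℕ → Poly → ℤ
  worker = _

  coefQ1-∷ : ∀ n c f → coefQ1 n (c ∷ f) ≡ + (0 C n) ℤ.* c ℤ.+ worker n (c ∷ f) 1 f
  coefQ1-∷ n c f with c ∷ f | 1
  -- With `c ∷ f` and `1` generalised to variables, the metavariable behind `worker` is applied to
  -- distinct variables, so `refl` determines it.
  ... | g | k = refl

-- The starting exponent is a parameter because multiplication by q moves it from 0 to 1.
coefFrom : ℕ → ℕ → Poly → ℤ
coefFrom n k []      = 0ℤ
coefFrom n k (c ∷ f) = + (k C n) ℤ.* c ℤ.+ coefFrom n (suc k) f

worker≡coefFrom : ∀ n g k f → worker n g k f ≡ coefFrom n k f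
worker≡coefFrom n g k []      = refl
worker≡coefFrom n g k (c ∷ f) = cong (ℤ._+_ (+ (k C n) ℤ.* c)) (worker≡coefFrom n g (suc k) f)

coefQ1≡coefFrom : ∀ n f → coefQ1 n f ≡ coefFrom n 0 f
coefQ1≡coefFrom n []      = refl
coefQ1≡coefFrom n (c ∷ f) = trans (coefQ1-∷ n c f) (cong (ℤ._+_ (+ (0 C n) ℤ.* c)) (worker≡coefFrom n (c ∷ f) 1 f))

coefFrom-⊕ : ∀ n k f g → coefFrom n k (f ⊕ g) ≡ coefFrom n k f ℤ.+ coefFrom n k g
coefFrom-⊕ n k []      g       = sym (ℤ.+-identityˡ _)
coefFrom-⊕ n k (a ∷ f) []      = sym (ℤ.+-identityʳ _)
coefFrom-⊕ n k (a ∷ f) (b ∷ g) =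
  trans (cong (ℤ._+_ (+ (k C n) ℤ.* (a ℤ.+ b))) (coefFrom-⊕ n (suc k) f g)) (rearrange (+ (k C n)) a b _ _)
  where
  rearrange : ∀ c a b x y → c ℤ.* (a ℤ.+ b) ℤ.+ (x ℤ.+ y) ≡ (c ℤ.* a ℤ.+ x) ℤ.+ (c ℤ.* b ℤ.+ y)
  rearrange = solve-∀

coefFrom-⊖ : ∀ n k f → coefFrom n k (⊖ f) ≡ ℤ.- coefFrom n k f
coefFrom-⊖ n k []      = refl
coefFrom-⊖ n k (a ∷ f) = trans (cong (ℤ._+_ (+ (k C n) ℤ.* ℤ.- a)) (coefFrom-⊖ n (suc k) f)) (rearrange (+ (k C n)) a _)
  where
  rearrange : ∀ c a x → c ℤ.* ℤ.- a ℤ.+ ℤ.- x ≡ ℤ.- (c ℤ.* a ℤ.+ x)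
  rearrange = solve-∀

coefFrom-zero : ∀ n k f → (∀ i → coeff f i ≡ 0ℤ) → coefFrom n k f ≡ 0ℤ
coefFrom-zero n k []      f≈0 = refl
coefFrom-zero n k (a ∷ f) f≈0 = cong₂ ℤ._+_
  (trans (cong (+ (k C n) ℤ.*_) (f≈0 0)) (ℤ.*-zeroʳ (+ (k C n))))
  (coefFrom-zero n (suc k) f (λ i → f≈0 (suc i)))

coefFrom-cong : ∀ n k f g → f ≈ₚ g → coefFrom n k f ≡ coefFrom n k g
coefFrom-cong n k []      g       f≈g = sym (coefFrom-zero n k g (λ i → sym (f≈g i)))
coefFrom-cong n k (a ∷ f) []      f≈g = coefFrom-zero n k (a ∷ f) f≈g
coefFrom-cong n k (a ∷ f) (b ∷ g) f≈g = cong₂ ℤ._+_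
  (cong (+ (k C n) ℤ.*_) (f≈g 0)) (coefFrom-cong n (suc k) f g (λ i → f≈g (suc i)))

-- Pascal's rule in each term. Raising the starting exponent multiplies by q = 1 + (q - 1), which
-- adds the previous coefficient.
coefFrom-pascal : ∀ n k f → coefFrom (suc n) (suc k) f ≡ coefFrom n k f ℤ.+ coefFrom (suc n) k f
coefFrom-pascal n k []      = refl
coefFrom-pascal n k (a ∷ f) =
  trans (cong₂ (λ c x → + c ℤ.* a ℤ.+ x) (sym (nCk+nC[k+1]≡[n+1]C[k+1] k n)) (coefFrom-pascal n (suc k) f))
        (rearrange (+ (k C n)) (+ (k C suc n)) a _ _)
  where
  rearrange : ∀ c d a x y → (c ℤ.+ d) ℤ.* a ℤ.+ (x ℤ.+ y) ≡ (c ℤ.* a ℤ.+ x) ℤ.+ (d ℤ.* a ℤ.+ y)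
  rearrange = solve-∀

-- For n = 0 all binomials are 1, so the sum is f(1) whatever the starting exponent.
coefFrom-0 : ∀ k f → coefFrom 0 (suc k) f ≡ coefFrom 0 k f
coefFrom-0 k []      = refl
coefFrom-0 k (a ∷ f) = cong (ℤ._+_ (1ℤ ℤ.* a)) (coefFrom-0 (suc k) f)

coefFrom-q : ∀ n f → coefFrom n 0 (q· f) ≡ coefFrom n 1 f
coefFrom-q n f = trans (cong (ℤ._+ coefFrom n 1 f) (ℤ.*-zeroʳ (+ (0 C n)))) (ℤ.+-identityˡ _)

coefQ1-cong : ∀ n f g → f ≈ₚ g → coefQ1 n f ≡ coefQ1 n g
coefQ1-cong n f g f≈g = begin
  coefQ1 n f     ≡⟨ coefQ1≡coefFrom n f ⟩
  coefFrom n 0 f ≡⟨ coefFrom-cong n 0 f g f≈g ⟩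
  coefFrom n 0 g ≡⟨ coefQ1≡coefFrom n g ⟨
  coefQ1 n g     ∎
  where open ≡-Reasoning

coefQ1-⊕ : ∀ n f g → coefQ1 n (f ⊕ g) ≡ coefQ1 n f ℤ.+ coefQ1 n g
coefQ1-⊕ n f g
  rewrite coefQ1≡coefFrom n (f ⊕ g) | coefQ1≡coefFrom n f | coefQ1≡coefFrom n g = coefFrom-⊕ n 0 f g

coefQ1-q-0 : ∀ f → coefQ1 0 (q· f) ≡ coefQ1 0 f
coefQ1-q-0 f rewrite coefQ1≡coefFrom 0 (q· f) | coefQ1≡coefFrom 0 f =
  trans (coefFrom-q 0 f) (coefFrom-0 0 f)

coefQ1-q-suc : ∀ n f → coefQ1 (suc n) (q· f) ≡ coefQ1 n f ℤ.+ coefQ1 (suc n) f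
coefQ1-q-suc n f
  rewrite coefQ1≡coefFrom (suc n) (q· f) | coefQ1≡coefFrom n f | coefQ1≡coefFrom (suc n) f =
  trans (coefFrom-q (suc n) f) (coefFrom-pascal n 0 f)

coefQ1-⊖ : ∀ n f → coefQ1 n (⊖ f) ≡ ℤ.- coefQ1 n f
coefQ1-⊖ n f rewrite coefQ1≡coefFrom n (⊖ f) | coefQ1≡coefFrom n f = coefFrom-⊖ n 0 f

coefQ1-q-1-0 : ∀ f → coefQ1 0 (q-1· f) ≡ 0ℤ
coefQ1-q-1-0 f = begin
  coefQ1 0 (q-1· f)                    ≡⟨ coefQ1-⊕ 0 (q· f) (⊖ f) ⟩
  coefQ1 0 (q· f) ℤ.+ coefQ1 0 (⊖ f)   ≡⟨ cong₂ ℤ._+_ (coefQ1-q-0 f) (coefQ1-⊖ 0 f) ⟩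
  coefQ1 0 f ℤ.+ ℤ.- coefQ1 0 f        ≡⟨ ℤ.+-inverseʳ (coefQ1 0 f) ⟩
  0ℤ                                   ∎
  where open ≡-Reasoning

coefQ1-q-1-suc : ∀ n f → coefQ1 (suc n) (q-1· f) ≡ coefQ1 n f
coefQ1-q-1-suc n f = begin
  coefQ1 (suc n) (q-1· f)                              ≡⟨ coefQ1-⊕ (suc n) (q· f) (⊖ f) ⟩
  coefQ1 (suc n) (q· f) ℤ.+ coefQ1 (suc n) (⊖ f)       ≡⟨ cong₂ ℤ._+_ (coefQ1-q-suc n f) (coefQ1-⊖ (suc n) f) ⟩
  (coefQ1 n f ℤ.+ coefQ1 (suc n) f) ℤ.- coefQ1 (suc n) f ≡⟨ cancel (coefQ1 n f) (coefQ1 (suc n) f) ⟩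
  coefQ1 n f                                           ∎
  where
  open ≡-Reasoning
  cancel : ∀ x y → (x ℤ.+ y) ℤ.- y ≡ x
  cancel = solve-∀

coefQ1-rec-0 : ∀ f g → coefQ1 0 ((q· f) ⊕ (q-1· g)) ≡ coefQ1 0 f
coefQ1-rec-0 f g = begin
  coefQ1 0 ((q· f) ⊕ (q-1· g))               ≡⟨ coefQ1-⊕ 0 (q· f) (q-1· g) ⟩
  coefQ1 0 (q· f) ℤ.+ coefQ1 0 (q-1· g)      ≡⟨ cong₂ ℤ._+_ (coefQ1-q-0 f) (coefQ1-q-1-0 g) ⟩
  coefQ1 0 f ℤ.+ 0ℤ                          ≡⟨ ℤ.+-identityʳ _ ⟩
  coefQ1 0 f                                 ∎
  where open ≡-Reasoning

coefQ1-rec-suc : ∀ n f g → coefQ1 (suc n) ((q· f) ⊕ (q-1· g)) ≡ (coefQ1 n f ℤ.+ coefQ1 (suc n) f) ℤ.+ coefQ1 n g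
coefQ1-rec-suc n f g =
  trans (coefQ1-⊕ (suc n) (q· f) (q-1· g)) (cong₂ ℤ._+_ (coefQ1-q-suc n f) (coefQ1-q-1-suc n g))

-- Divisibility by powers of q - 1.

-- Synthetic division by q - 1: the quotient of c + q f is f(1) + q (f / (q - 1)).
quotient : Poly → Poly
quotient []      = []
quotient (c ∷ f) = coefFrom 0 0 f ∷ quotient f

coeff-⊕ : ∀ f g i → coeff (f ⊕ g) i ≡ coeff f i ℤ.+ coeff g i
coeff-⊕ []      g       i       = sym (ℤ.+-identityˡ _)
coeff-⊕ (a ∷ f) []      i       = sym (ℤ.+-identityʳ _)
coeff-⊕ (a ∷ f) (b ∷ g) zero    = refl
coeff-⊕ (a ∷ f) (b ∷ g) (suc i) = coeff-⊕ f g i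

coeff-⊖ : ∀ f i → coeff (⊖ f) i ≡ ℤ.- coeff f i
coeff-⊖ []      i       = refl
coeff-⊖ (a ∷ f) zero    = refl
coeff-⊖ (a ∷ f) (suc i) = coeff-⊖ f i

coeff-q-1-0 : ∀ f → coeff (q-1· f) 0 ≡ ℤ.- coeff f 0
coeff-q-1-0 f = trans (coeff-⊕ (q· f) (⊖ f) 0) (trans (ℤ.+-identityˡ _) (coeff-⊖ f 0))

coeff-q-1-suc : ∀ f i → coeff (q-1· f) (suc i) ≡ coeff f i ℤ.- coeff f (suc i)
coeff-q-1-suc f i = trans (coeff-⊕ (q· f) (⊖ f) (suc i)) (cong (ℤ._+_ (coeff f i)) (coeff-⊖ f (suc i)))

coeff-quotient-0 : ∀ f → coeff f 0 ℤ.+ coeff (quotient f) 0 ≡ coefFrom 0 0 f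
coeff-quotient-0 []      = refl
coeff-quotient-0 (c ∷ f) = cong₂ ℤ._+_ (sym (ℤ.*-identityˡ c)) (sym (coefFrom-0 0 f))

coeff-quotient-suc : ∀ f i → coeff f (suc i) ≡ coeff (quotient f) i ℤ.- coeff (quotient f) (suc i)
coeff-quotient-suc []      i       = refl
coeff-quotient-suc (c ∷ f) zero    =
  trans (cancel (coeff f 0) _) (cong (ℤ._- coeff (quotient f) 0) (coeff-quotient-0 f))
  where
  cancel : ∀ x y → x ≡ (x ℤ.+ y) ℤ.- y
  cancel = solve-∀
coeff-quotient-suc (c ∷ f) (suc i) = coeff-quotient-suc f i

-- Factor theorem. The remainder f(1) affects only the constant coefficient, so the hypothesis
-- enters only at index 0.
q-1·quotient : ∀ f → coefQ1 0 f ≡ 0ℤ → f ≈ₚ (q-1· quotient f)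
q-1·quotient f f[1]≡0 zero    = begin
  coeff f 0                    ≡⟨ cancel (coeff f 0) d ⟩
  (coeff f 0 ℤ.+ d) ℤ.- d      ≡⟨ cong (ℤ._- d) (coeff-quotient-0 f) ⟩
  coefFrom 0 0 f ℤ.- d         ≡⟨ cong (ℤ._- d) (trans (sym (coefQ1≡coefFrom 0 f)) f[1]≡0) ⟩
  0ℤ ℤ.- d                     ≡⟨ ℤ.+-identityˡ _ ⟩
  ℤ.- d                        ≡⟨ coeff-q-1-0 (quotient f) ⟨
  coeff (q-1· quotient f) 0    ∎
  where
  open ≡-Reasoning
  d : ℤ
  d = coeff (quotient f) 0
  cancel : ∀ x y → x ≡ (x ℤ.+ y) ℤ.- y
  cancel = solve-∀
q-1·quotient f f[1]≡0 (suc i) = trans (coeff-quotient-suc f i) (sym (coeff-q-1-suc (quotient f) i))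

q-1·-cong : ∀ f g → f ≈ₚ g → (q-1· f) ≈ₚ (q-1· g)
q-1·-cong f g f≈g zero    = trans (coeff-q-1-0 f) (trans (cong ℤ.-_ (f≈g 0)) (sym (coeff-q-1-0 g)))
q-1·-cong f g f≈g (suc i) =
  trans (coeff-q-1-suc f i) (trans (cong₂ ℤ._-_ (f≈g i) (f≈g (suc i))) (sym (coeff-q-1-suc g i)))

-- Division by q - 1 shifts the expansion down by one, so the vanishing of the first k + 1
-- coefficients passes to the first k of the quotient.
coefs-zero⇒Q1Divides : ∀ k f → (∀ n → n < k → coefQ1 n f ≡ 0ℤ) → Q1Divides k f
coefs-zero⇒Q1Divides zero    f _  = f , λ _ → refl
coefs-zero⇒Q1Divides (suc k) f f₀ with coefs-zero⇒Q1Divides k (quotient f) quotient₀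
  where
  quotient₀ : ∀ n → n < k → coefQ1 n (quotient f) ≡ 0ℤ
  quotient₀ n n<k = begin
    coefQ1 n (quotient f)               ≡⟨ coefQ1-q-1-suc n (quotient f) ⟨
    coefQ1 (suc n) (q-1· quotient f)    ≡⟨ coefQ1-cong (suc n) f (q-1· quotient f) (q-1·quotient f (f₀ 0 (s≤s z≤n))) ⟨
    coefQ1 (suc n) f                    ≡⟨ f₀ (suc n) (s≤s n<k) ⟩
    0ℤ                                  ∎
    where open ≡-Reasoning
... | g , eq = g , λ i → trans (q-1·quotient f (f₀ 0 (s≤s z≤n)) i) (q-1·-cong (quotient f) (q-1^ k · g) eq i)

Q1Divides⇒coefs-zero : ∀ k f → Q1Divides k f → ∀ n → n < k → coefQ1 n f ≡ 0ℤ
Q1Divides⇒coefs-zero k f (g , eq) n n<k = trans (coefQ1-cong n f (q-1^ k · g) eq) (power k n n<k)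
  where
  power : ∀ k n → n < k → coefQ1 n (q-1^ k · g) ≡ 0ℤ
  power (suc k) zero    _         = coefQ1-q-1-0 (q-1^ k · g)
  power (suc k) (suc n) (s≤s n<k) = trans (coefQ1-q-1-suc n (q-1^ k · g)) (power k n n<k)

open RawMonad (¬¬-Monad {0ℓ}) using (_>>=_; pure)

xor-false⇒≡ : ∀ a b → a xor b ≡ false → a ≡ b
xor-false⇒≡ false false _ = refl
xor-false⇒≡ true  true  _ = refl

module CoxeterSystem {I : Set} {m : I → I → ℕ} (isCoxeter : IsCoxeterMatrix m) where

  open Coxeter m

  private variable
    x y z t t′ u v w : Word
    s : I
    a b c : Bool
    n k : ℕ

  -- Words as group elements, inverses and conjugation.

  ∼-setoid : Setoid 0ℓ 0ℓ
  ∼-setoid = record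
    { Carrier = Word ; _≈_ = _∼_
    ; isEquivalence = record { refl = ∼-refl ; sym = ∼-sym ; trans = ∼-trans } }

  ≡⇒∼ : x ≡ y → x ∼ y
  ≡⇒∼ refl = ∼-refl

  ++-congˡ : ∀ x → y ∼ z → x ++ y ∼ x ++ z
  ++-congˡ {y} {z} x y∼z =
    subst₂ (λ p q → x ++ p ∼ x ++ q) (++-identityʳ y) (++-identityʳ z) (∼-ctx x [] y∼z)

  ++-congʳ : ∀ z → x ∼ y → x ++ z ∼ y ++ z
  ++-congʳ z x∼y = ∼-ctx [] z x∼y

  ++-cong : x ∼ y → z ∼ t → x ++ z ∼ y ++ t
  ++-cong {y = y} {z = z} x∼y z∼t = ∼-trans (++-congʳ z x∼y) (++-congˡ y z∼t)

  involutive : ∀ s → s ∷ s ∷ [] ∼ []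
  involutive s = subst (λ k → alt s s (2 * k) ∼ []) (proj₁ isCoxeter s)
    (∼-rel s s (λ m≡0 → contradiction (trans (sym (proj₁ isCoxeter s)) m≡0) λ ()))

  inverseʳ : ∀ x → x ++ reverse x ∼ []
  inverseʳ []      = ∼-refl
  inverseʳ (s ∷ x) = begin
    s ∷ x ++ reverse (s ∷ x)       ≡⟨ cong (λ r → s ∷ x ++ r) (unfold-reverse s x) ⟩
    s ∷ x ++ (reverse x ++ [ s ])  ≡⟨ cong (s ∷_) (++-assoc x (reverse x) [ s ]) ⟨
    s ∷ (x ++ reverse x) ++ [ s ]  ≈⟨ ∼-ctx [ s ] [ s ] (inverseʳ x) ⟩
    s ∷ s ∷ []                     ≈⟨ involutive s ⟩
    []                             ∎
    where open SetoidReasoning ∼-setoid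

  inverseˡ : ∀ x → reverse x ++ x ∼ []
  inverseˡ x = subst (λ y → reverse x ++ y ∼ []) (reverse-involutive x) (inverseʳ (reverse x))

  cancelˡ : ∀ x y → x ++ y ∼ [] → ∀ z → x ++ (y ++ z) ∼ z
  cancelˡ x y xy∼1 z = ∼-trans (≡⇒∼ (sym (++-assoc x y z))) (++-congʳ z xy∼1)

  cancelʳ : ∀ x y → x ++ y ∼ [] → ∀ z → (z ++ x) ++ y ∼ z
  cancelʳ x y xy∼1 z = begin
    (z ++ x) ++ y   ≡⟨ ++-assoc z x y ⟩
    z ++ (x ++ y)   ≈⟨ ++-congˡ z xy∼1 ⟩
    z ++ []         ≡⟨ ++-identityʳ z ⟩
    z               ∎
    where open SetoidReasoning ∼-setoid

  reverse-cong : x ∼ y → reverse x ∼ reverse y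
  reverse-cong {x} {y} x∼y = begin
    reverse x                     ≈⟨ cancelʳ y (reverse y) (inverseʳ y) (reverse x) ⟨
    (reverse x ++ y) ++ reverse y ≈⟨ ++-congʳ (reverse y) (++-congˡ (reverse x) x∼y) ⟨
    (reverse x ++ x) ++ reverse y ≈⟨ ++-congʳ (reverse y) (inverseˡ x) ⟩
    reverse y                     ∎
    where open SetoidReasoning ∼-setoid

  ·s·s : ∀ x s → (x ++ [ s ]) ++ [ s ] ∼ x
  ·s·s x s = cancelʳ [ s ] [ s ] (involutive s) x

  conj conj⁻¹ : Word → Word → Word
  conj   y t = y ++ (t ++ reverse y)
  conj⁻¹ y t = reverse y ++ (t ++ y)

  conj-cong : x ∼ y → t ∼ t′ → conj x t ∼ conj y t′
  conj-cong x∼y t∼t′ = ++-cong x∼y (++-cong t∼t′ (reverse-cong x∼y))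

  conj⁻¹-congʳ : ∀ x → t ∼ t′ → conj⁻¹ x t ∼ conj⁻¹ x t′
  conj⁻¹-congʳ x t∼t′ = ∼-ctx (reverse x) x t∼t′

  private
    unconj : ∀ x y t → x ++ y ∼ [] → x ++ ((y ++ (t ++ x)) ++ y) ∼ t
    unconj x y t xy∼1 = begin
      x ++ ((y ++ (t ++ x)) ++ y) ≡⟨ cong (x ++_) (++-assoc y (t ++ x) y) ⟩
      x ++ (y ++ ((t ++ x) ++ y)) ≈⟨ cancelˡ x y xy∼1 _ ⟩
      (t ++ x) ++ y               ≈⟨ cancelʳ x y xy∼1 t ⟩
      t                           ∎
      where open SetoidReasoning ∼-setoid

  conj⁻¹-conj : ∀ y t → conj⁻¹ y (conj y t) ∼ t
  conj⁻¹-conj y t = unconj (reverse y) y t (inverseˡ y)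

  conj-conj⁻¹ : ∀ y t → conj y (conj⁻¹ y t) ∼ t
  conj-conj⁻¹ y t = unconj y (reverse y) t (inverseʳ y)

  conj⁻¹-++ : ∀ x y t → conj⁻¹ (x ++ y) t ≡ conj⁻¹ y (conj⁻¹ x t)
  conj⁻¹-++ x y t = begin
    reverse (x ++ y) ++ (t ++ (x ++ y))             ≡⟨ cong₂ _++_ (reverse-++ x y) (sym (++-assoc t x y)) ⟩
    (reverse y ++ reverse x) ++ ((t ++ x) ++ y)     ≡⟨ ++-assoc (reverse y) (reverse x) _ ⟩
    reverse y ++ (reverse x ++ ((t ++ x) ++ y))     ≡⟨ cong (reverse y ++_) (++-assoc (reverse x) (t ++ x) y) ⟨
    reverse y ++ ((reverse x ++ (t ++ x)) ++ y)     ∎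
    where open ≡-Reasoning

  conj-swap : ∀ y → conj y t ∼ z → t ∼ conj⁻¹ y z
  conj-swap {t} y yt∼z = ∼-trans (∼-sym (conj⁻¹-conj y t)) (conj⁻¹-congʳ y yt∼z)

  conj⁻¹-swap : ∀ y → t ∼ conj⁻¹ y z → conj y t ∼ z
  conj⁻¹-swap {z = z} y t∼yz = ∼-trans (conj-cong {y} ∼-refl t∼yz) (conj-conj⁻¹ y z)

  -- Parity of the reflection cocycle

  -- Parity x t b: the number of letters s of x = x₁ s x₂ with t = x₂⁻¹ s x₂ is odd iff b.
  -- Equality in W is not decidable a priori, so this is a relation rather than a function.
  data Parity : Word → Word → Bool → Set where
    []   : Parity [] t false
    hit  : t ∼ conj⁻¹ x [ s ] → Parity x t b → Parity (s ∷ x) t (not b)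
    miss : ¬ t ∼ conj⁻¹ x [ s ] → Parity x t b → Parity (s ∷ x) t b

  parity-total : ∀ x t → ¬ ¬ ∃ (Parity x t)
  parity-total []      t = pure (false , [])
  parity-total (s ∷ x) t = do
    b , p ← parity-total x t
    yes h ← ¬¬-excluded-middle
      where no h → pure (b , miss h p)
    pure (not b , hit h p)

  parity-unique : t ∼ t′ → Parity x t a → Parity x t′ b → a ≡ b
  parity-unique t∼t′ []         []         = refl
  parity-unique t∼t′ (hit h p)  (hit _ q)  = cong not (parity-unique t∼t′ p q)
  parity-unique t∼t′ (hit h p)  (miss h′ q) = contradiction (∼-trans (∼-sym t∼t′) h) h′
  parity-unique t∼t′ (miss h p) (hit h′ q) = contradiction (∼-trans t∼t′ h′) h
  parity-unique t∼t′ (miss _ p) (miss _ q) = parity-unique t∼t′ p q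

  -- Cocycle identity: the reflections of x y are those of x conjugated by y⁻¹, together with those
  -- of y.
  parity-++ : ∀ y → Parity x (conj y t) a → Parity y t b → Parity (x ++ y) t (a xor b)
  parity-++ y [] q = q
  parity-++ {t = t} {b = b} y (hit {x = x} {s = s} {b = a} h p) q =
    subst (Parity (s ∷ x ++ y) t) (not-distribˡ-xor a b)
      (hit (∼-trans (conj-swap y h) (≡⇒∼ (sym (conj⁻¹-++ x y [ s ])))) (parity-++ y p q))
  parity-++ y (miss {x = x} {s = s} h p) q =
    miss (λ h′ → h (conj⁻¹-swap y (∼-trans h′ (≡⇒∼ (conj⁻¹-++ x y [ s ]))))) (parity-++ y p q)

  -- Reflections of alternating words and invariance of the parity.

  first : I → I → ℕ → I
  first e f zero    = e
  first e f (suc k) = first f e k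

  -- The alternating word of length k ending in e. Unlike alt, its tails are again of this form,
  -- so its reflections are the palindromes e, efe, efefe, …
  tla : I → I → ℕ → Word
  tla e f zero    = []
  tla e f (suc k) = first e f k ∷ tla e f k

  palindrome : I → I → ℕ → Word
  palindrome e f zero    = [ e ]
  palindrome e f (suc k) = e ∷ f ∷ palindrome e f k

  tla-∷ʳ : ∀ e f k → tla e f (suc k) ≡ tla f e k ++ [ e ]
  tla-∷ʳ e f zero    = refl
  tla-∷ʳ e f (suc k) = cong (first f e k ∷_) (tla-∷ʳ e f k)

  palindrome-∷ʳ : ∀ e f k → palindrome f e k ++ [ e ] ≡ f ∷ palindrome e f k
  palindrome-∷ʳ e f zero    = refl
  palindrome-∷ʳ e f (suc k) = cong (λ p → f ∷ e ∷ p) (palindrome-∷ʳ e f k)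

  -- Splitting off the last letter e leaves an alternating word ending in f; conjugation by e then
  -- extends its palindrome at both ends.
  tla-reflection : ∀ e f k → conj⁻¹ (tla e f k) [ first e f k ] ≡ palindrome e f k
  tla-reflection e f zero    = refl
  tla-reflection e f (suc k) = begin
    conj⁻¹ (tla e f (suc k)) [ first f e k ]            ≡⟨ cong (λ p → conj⁻¹ p [ first f e k ]) (tla-∷ʳ e f k) ⟩
    conj⁻¹ (tla f e k ++ [ e ]) [ first f e k ]         ≡⟨ conj⁻¹-++ (tla f e k) [ e ] _ ⟩
    e ∷ (conj⁻¹ (tla f e k) [ first f e k ] ++ [ e ])   ≡⟨ cong (λ p → e ∷ (p ++ [ e ])) (tla-reflection f e k) ⟩
    e ∷ (palindrome f e k ++ [ e ])                     ≡⟨ cong (e ∷_) (palindrome-∷ʳ e f k) ⟩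
    palindrome e f (suc k)                              ∎
    where open ≡-Reasoning

  palindrome-+ : ∀ e f k j → palindrome e f (k + j) ≡ alt e f (2 * k) ++ palindrome e f j
  palindrome-+ e f zero    j = refl
  palindrome-+ e f (suc k) j rewrite +-suc k (k + 0) = cong (λ p → e ∷ f ∷ p) (palindrome-+ e f k j)

  first-even : ∀ e f k → first e f (2 * k) ≡ e
  first-even e f zero    = refl
  first-even e f (suc k) rewrite +-suc k (k + 0) = first-even e f k

  alt≡tla : ∀ e f k → alt f e (2 * k) ≡ tla e f (2 * k)
  alt≡tla e f zero    = refl
  alt≡tla e f (suc k) rewrite +-suc k (k + 0) =
    cong₂ _∷_ (sym (first-even f e k)) (cong₂ _∷_ (sym (first-even e f k)) (alt≡tla e f k))

  -- The palindromes are (ef)^j e, so a relation (ef)^k = 1 makes their sequence k-periodic in W.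
  palindrome-periodic : ∀ e f k j → alt e f (2 * k) ∼ [] → palindrome e f (j + k) ∼ palindrome e f j
  palindrome-periodic e f k j rel = begin
    palindrome e f (j + k)                     ≡⟨ cong (palindrome e f) (+-comm j k) ⟩
    palindrome e f (k + j)                     ≡⟨ palindrome-+ e f k j ⟩
    alt e f (2 * k) ++ palindrome e f j        ≈⟨ ++-congʳ _ rel ⟩
    palindrome e f j                           ∎
    where open SetoidReasoning ∼-setoid

  -- By periodicity the j letters in front of `tla e f k` carry the same reflections as the letters
  -- of `tla e f j`, so the two parities add.
  parity-tla-+ : ∀ e f k → alt e f (2 * k) ∼ [] → ∀ j →
                 Parity (tla e f k) t b → Parity (tla e f j) t a → Parity (tla e f (j + k)) t c → c ≡ a xor b
  parity-tla-+ {t = t} e f k rel j₀ pk = go j₀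
    where
    reflection-periodic : ∀ j → conj⁻¹ (tla e f (j + k)) [ first e f (j + k) ] ∼ conj⁻¹ (tla e f j) [ first e f j ]
    reflection-periodic j = ∼-trans (≡⇒∼ (tla-reflection e f (j + k)))
      (∼-trans (palindrome-periodic e f k j rel) (≡⇒∼ (sym (tla-reflection e f j))))

    go : ∀ j → Parity (tla e f j) t a → Parity (tla e f (j + k)) t c → c ≡ a xor _
    go zero    []         q           = parity-unique ∼-refl q pk
    go (suc j) (hit {b = a} h p)  (hit _ q)   = trans (cong not (go j p q)) (not-distribˡ-xor a _)
    go (suc j) (miss _ p) (miss _ q)  = go j p q
    go (suc j) (hit h p)  (miss h′ q) = contradiction (∼-trans h (∼-sym (reflection-periodic j))) h′
    go (suc j) (miss h p) (hit h′ q)  = contradiction (∼-trans h′ (reflection-periodic j)) h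

  -- The two halves of a relator carry the same m reflections, so its parity is that of one half
  -- added to itself.
  parity-relator : ∀ s t′ → ¬ m s t′ ≡ 0 → Parity (alt s t′ (2 * m s t′)) t b → b ≡ false
  parity-relator {t = r} {b = b} s t m≢0 p = decidable-stable (b ≟ᵇ false) do
    a , q ← parity-total (tla t s (m s t)) r
    pure (trans (parity-tla-+ t s (m s t) rel (m s t) q q p′) (xor-same a))
    where
    -- `alt s t` of even length ends in t, hence equals `tla t s`, and the relation is needed for
    -- the swapped pair.
    m-sym : m t s ≡ m s t
    m-sym = proj₁ (proj₂ isCoxeter) t s
    rel : alt t s (2 * m s t) ∼ []
    rel = subst (λ k → alt t s (2 * k) ∼ []) m-sym (∼-rel t s (m≢0 ∘ trans (sym m-sym)))
    p′ : Parity (tla t s (m s t + m s t)) r b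
    p′ = subst (λ k → Parity (tla t s (m s t + k)) r b) (+-identityʳ (m s t))
           (subst (λ x → Parity x r b) (alt≡tla t s (m s t)) p)

  -- Parity is a function on W. In a context d, e the cocycle identity splits the count: e
  -- contributes equally on both sides, and so does d, because it sees conjugates by x e and y e,
  -- which are equal in W. Only x against y remains.
  parity-∼ : x ∼ y → Parity x t a → Parity y t b → a ≡ b
  parity-∼ ∼-refl        p q = parity-unique ∼-refl p q
  parity-∼ (∼-sym y∼x)   p q = sym (parity-∼ y∼x q p)
  parity-∼ {t = t} {a = a} {b = b} (∼-trans {y = y} x∼y y∼z) p q = decidable-stable (a ≟ᵇ b) do
    _ , r ← parity-total y t
    pure (trans (parity-∼ x∼y p r) (parity-∼ y∼z r q))
  parity-∼ {t = t} {a = a} {b = b} (∼-ctx d e {x} {y} x∼y) p q = decidable-stable (a ≟ᵇ b) do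
    _ , pd ← parity-total d (conj (x ++ e) t)
    _ , qd ← parity-total d (conj (y ++ e) t)
    _ , px ← parity-total x (conj e t)
    _ , qy ← parity-total y (conj e t)
    _ , pe ← parity-total e t
    let a≡ = parity-unique ∼-refl p (parity-++ (x ++ e) pd (parity-++ e px pe))
        b≡ = parity-unique ∼-refl q (parity-++ (y ++ e) qd (parity-++ e qy pe))
        d≡ = parity-unique (conj-cong (++-congʳ e x∼y) ∼-refl) pd qd
    pure (trans a≡ (trans (cong₂ (λ i j → i xor (j xor _)) d≡ (parity-∼ x∼y px qy)) (sym b≡)))
  parity-∼ (∼-rel s t m≢0) p [] = parity-relator s t m≢0 p

  -- Strong exchange

  -- An odd count is nonzero, so x = x₁ s x₂ with t = x₂⁻¹ s x₂ for some letter s, and then x t = x₁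
  -- x₂.
  parity-true⇒deletion : Parity x t b → b ≡ true → ∃[ y ] (y ∼ x ++ t × suc (length y) ≡ length x)
  parity-true⇒deletion {t = t} (hit {x = x} {s = s} h p) _ = x , x∼sxt , refl
    where
    open SetoidReasoning ∼-setoid
    x∼sxt : x ∼ s ∷ x ++ t
    x∼sxt = begin
      x                                   ≈⟨ cancelˡ [ s ] [ s ] (involutive s) x ⟨
      s ∷ s ∷ x                           ≈⟨ ++-congˡ [ s ] (cancelˡ x (reverse x) (inverseʳ x) (s ∷ x)) ⟨
      s ∷ x ++ (reverse x ++ (s ∷ x))     ≈⟨ ++-congˡ (s ∷ x) h ⟨
      s ∷ x ++ t                          ∎
  parity-true⇒deletion (miss {s = s} _ p) b≡true with parity-true⇒deletion p b≡true
  ... | y , y∼xt , ∣y∣ = s ∷ y , ++-congˡ [ s ] y∼xt , cong suc ∣y∣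

  reflection-involutive : IsReflection t → t ++ t ∼ []
  reflection-involutive {t} (x , s , t∼) = begin
    t ++ t                                              ≈⟨ ++-cong t∼ t∼ ⟩
    (reverse x ++ (s ∷ x)) ++ (reverse x ++ (s ∷ x))    ≡⟨ ++-assoc (reverse x) (s ∷ x) _ ⟩
    reverse x ++ (s ∷ x ++ (reverse x ++ (s ∷ x)))
      ≈⟨ ++-congˡ (reverse x) (++-congˡ [ s ] (cancelˡ x (reverse x) (inverseʳ x) (s ∷ x))) ⟩
    reverse x ++ (s ∷ s ∷ x)                            ≈⟨ ++-congˡ (reverse x) (++-congʳ x (involutive s)) ⟩
    reverse x ++ x                                      ≈⟨ inverseˡ x ⟩
    []                                                  ∎
    where open SetoidReasoning ∼-setoid

  -- Write t = x⁻¹ s x. The outer factors x⁻¹ and x contribute equal parities, since x⁻¹ x = 1 has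
  -- parity false; the middle letter s adds one more occurrence.
  parity-self : IsReflection t → Parity t t b → b ≡ true
  parity-self {t} {b} (x , s , t∼) p = decidable-stable (b ≟ᵇ true) do
    c , px  ← parity-total x t
    a , pl  ← parity-total (reverse x) (conj x t)
    a′ , pl′ ← parity-total (reverse x) (conj (s ∷ x) t)
    let a≡c = xor-false⇒≡ a c (sym (parity-∼ (∼-sym (inverseˡ x)) [] (parity-++ x pl px)))
        a′≡a = parity-unique (∼-trans conj-sx (∼-sym conj-x)) pl′ pl
    pure (trans (parity-∼ t∼ p (parity-++ (s ∷ x) pl′ (hit t∼ px)))
                (trans (cong (_xor not c) (trans a′≡a a≡c)) (xor-inverseʳ c)))
    where
    open SetoidReasoning ∼-setoid
    conj-x : conj x t ∼ [ s ]
    conj-x = conj⁻¹-swap x t∼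
    conj-sx : conj (s ∷ x) t ∼ [ s ]
    conj-sx = begin
      s ∷ x ++ (t ++ reverse (s ∷ x))        ≡⟨ cong (λ r → s ∷ x ++ (t ++ r)) (unfold-reverse s x) ⟩
      s ∷ x ++ (t ++ (reverse x ++ [ s ]))   ≡⟨ cong (λ r → s ∷ x ++ r) (++-assoc t (reverse x) [ s ]) ⟨
      s ∷ x ++ ((t ++ reverse x) ++ [ s ])   ≡⟨ cong (s ∷_) (++-assoc x (t ++ reverse x) [ s ]) ⟨
      s ∷ conj x t ++ [ s ]                  ≈⟨ ∼-ctx [ s ] [ s ] conj-x ⟩
      s ∷ s ∷ s ∷ []                         ≈⟨ ++-congʳ [ s ] (involutive s) ⟩
      [ s ]                                  ∎

  -- Length

  IsLength-resp : x ∼ y → IsLength x n → IsLength y n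
  IsLength-resp x∼y ((z , z∼x , ∣z∣) , min) =
    (z , ∼-trans z∼x x∼y , ∣z∣) , λ v v∼y → min v (∼-trans v∼y (∼-sym x∼y))

  IsLength-unique : IsLength x n → IsLength x k → n ≡ k
  IsLength-unique ((y , y∼x , refl) , min) ((z , z∼x , refl) , min′) = ≤-antisym (min z z∼x) (min′ y y∼x)

  IsLength-total : ∀ x → ¬ ¬ ∃ (IsLength x)
  IsLength-total x = go (suc (length x)) x ∼-refl ≤-refl
    where
    go : ∀ n y → y ∼ x → length y < n → ¬ ¬ ∃ (IsLength x)
    go (suc n) y y∼x (s≤s ∣y∣≤n) = do
      yes (z , z∼x , ∣z∣<∣y∣) ← ¬¬-excluded-middle {A = ∃[ z ] (z ∼ x × length z < length y)}
        where no ∄z → pure (length y , (y , y∼x , refl) , λ z z∼x → ≮⇒≥ λ ∣z∣<∣y∣ → ∄z (z , z∼x , ∣z∣<∣y∣))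
      go n z z∼x (≤-trans ∣z∣<∣y∣ ∣y∣≤n)

  IsLength-++ : ∀ y → IsLength x n → IsLength (x ++ y) k → k ≤ n + length y
  IsLength-++ y ((z , z∼x , refl) , _) (_ , min) =
    ≤-trans (min (z ++ y) (++-congʳ y z∼x)) (≤-reflexive (length-++ z))

  IsLength-·s : ∀ s → IsLength x n → IsLength (x ++ [ s ]) k → k ≤ suc n
  IsLength-·s {n = n} s ℓx ℓxs = ≤-trans (IsLength-++ [ s ] ℓx ℓxs) (≤-reflexive (+-comm n 1))

  Shorter-resp : x ∼ y → z ∼ t → Shorter x z → Shorter y t
  Shorter-resp x∼y z∼t (i , j , ℓi , ℓj , i<j) = i , j , IsLength-resp x∼y ℓi , IsLength-resp z∼t ℓj , i<j

  Shorter⇒< : IsLength x n → IsLength y k → Shorter x y → n < k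
  Shorter⇒< ℓx ℓy (_ , _ , ℓx′ , ℓy′ , i<j) = subst₂ _<_ (IsLength-unique ℓx′ ℓx) (IsLength-unique ℓy′ ℓy) i<j

  Shorter-asym : Shorter x y → ¬ Shorter y x
  Shorter-asym x<y (_ , _ , ℓy , ℓx , j<i) = ℕ.<-asym j<i (Shorter⇒< ℓx ℓy x<y)

  -- By invariance the parity can be read from a shortest word for x; deleting a letter there gives
  -- a shorter word for x t.
  parity-true⇒Shorter : Parity x t b → b ≡ true → ¬ ¬ Shorter (x ++ t) x
  parity-true⇒Shorter {x} {t} p b≡true = do
    n , ℓxt@(_ , min) ← IsLength-total (x ++ t)
    k , ℓx@((y , y∼x , ∣y∣≡k) , _) ← IsLength-total x
    c , q ← parity-total y t
    let z , z∼yt , ∣z∣ = parity-true⇒deletion q (trans (parity-∼ y∼x q p) b≡true)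
    pure (n , k , ℓxt , ℓx ,
          ≤-trans (s≤s (min z (∼-trans z∼yt (++-congʳ t y∼x)))) (≤-reflexive (trans ∣z∣ ∣y∣≡k)))

  -- Multiplying by t flips the parity at t, since t has odd parity at itself and commutes with
  -- itself. So x t has odd parity, and multiplying it by t goes down to x.
  parity-false⇒Shorter : IsReflection t → Parity x t b → b ≡ false → ¬ ¬ Shorter x (x ++ t)
  parity-false⇒Shorter {t} {x} refl-t p refl = do
    a , q ← parity-total x (conj t t)
    b , r ← parity-total t t
    let a≡false = parity-unique tttt⁻¹ q p
        b≡true  = parity-self refl-t r
    xt<x ← parity-true⇒Shorter (parity-++ t q r) (cong₂ _xor_ a≡false b≡true)
    pure (Shorter-resp (cancelʳ t t (reflection-involutive refl-t) x) ∼-refl xt<x)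
    where
    tttt⁻¹ : conj t t ∼ t
    tttt⁻¹ = ∼-trans (++-congˡ t (inverseʳ t)) (≡⇒∼ (++-identityʳ t))

  isReflection-s : ∀ s → IsReflection [ s ]
  isReflection-s s = [] , s , ∼-refl

  compare-·s : ∀ x s → ¬ ¬ (Shorter (x ++ [ s ]) x ⊎ Shorter x (x ++ [ s ]))
  compare-·s x s = do
    true , p ← parity-total x [ s ]
      where false , p → do x<xs ← parity-false⇒Shorter (isReflection-s s) p refl
                           pure (inj₂ x<xs)
    xs<x ← parity-true⇒Shorter p refl
    pure (inj₁ xs<x)

  -- Paths in the Bruhat graph

  ⟶-·s : Shorter x (x ++ [ s ]) → x ⟶ x ++ [ s ]
  ⟶-·s {s = s} x<xs = [ s ] , isReflection-s s , ∼-refl , x<xs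

  ⟶-resp : x ∼ y → u ∼ v → x ⟶ u → y ⟶ v
  ⟶-resp x∼y u∼v (t , refl-t , u∼xt , x<u) =
    t , refl-t , ∼-trans (∼-sym u∼v) (∼-trans u∼xt (++-congʳ t x∼y)) , Shorter-resp x∼y u∼v x<u

  Path-resp : x ∼ y → u ∼ v → Path x u n → Path y v n
  Path-resp x∼y u∼v (here x∼u)   = here (∼-trans (∼-sym x∼y) (∼-trans x∼u u∼v))
  Path-resp x∼y u∼v (step e path) = step (⟶-resp x∼y ∼-refl e) (Path-resp ∼-refl u∼v path)

  Path-∷ʳ : Path x y n → y ⟶ z → Path x z (suc n)
  Path-∷ʳ (here x∼y)    e = step (⟶-resp (∼-sym x∼y) ∼-refl e) (here ∼-refl)
  Path-∷ʳ (step e path) f = step e (Path-∷ʳ path f)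

  Path-length : Path x y n → ∀ {i j} → IsLength x i → IsLength y j → n + i ≤ j
  Path-length (here x∼y) ℓx ℓy = ≤-reflexive (IsLength-unique (IsLength-resp x∼y ℓx) ℓy)
  Path-length {n = suc n} (step (_ , _ , _ , i , k , ℓx′ , ℓv , i<k) path) {i₀} ℓx ℓy
    rewrite IsLength-unique ℓx ℓx′ =
    ≤-trans (≤-reflexive (sym (+-suc n i))) (≤-trans (ℕ.+-monoʳ-≤ n i<k) (Path-length path ℓv ℓy))

  -- With v = x t, the cocycle at (x s , s t s) differs from that at (x , t) only by [t = s].
  ⟶-shift : ∀ s → x ⟶ v → ¬ v ∼ x ++ [ s ] → ¬ ¬ (x ++ [ s ] ⟶ v ++ [ s ])
  ⟶-shift {x} {v} s (t , (y , r , t∼) , v∼xt , x<v) v≁xs = do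
    false , p ← parity-total x t
      where true , p → do xt<x ← parity-true⇒Shorter p refl
                          contradiction (Shorter-resp (∼-sym v∼xt) ∼-refl xt<x) (Shorter-asym x<v)
    a , q ← parity-total x (conj [ s ] sts)
    xs<xssts ← parity-false⇒Shorter sts-refl (parity-++ [ s ] q (miss sts≁s []))
                 (cong (_xor false) (parity-unique (conj-conj⁻¹ [ s ] t) q p))
    pure (sts , sts-refl , vs∼xssts , Shorter-resp ∼-refl (∼-sym vs∼xssts) xs<xssts)
    where
    open SetoidReasoning ∼-setoid
    sts : Word
    sts = conj⁻¹ [ s ] t
    sts-refl : IsReflection sts
    sts-refl = y ++ [ s ] , r , ∼-trans (conj⁻¹-congʳ [ s ] t∼) (≡⇒∼ (sym (conj⁻¹-++ y [ s ] [ r ])))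
    sts≁s : ¬ sts ∼ [ s ]
    sts≁s sts∼s = v≁xs (∼-trans v∼xt (++-congˡ x (begin
      t                    ≈⟨ conj-conj⁻¹ [ s ] t ⟨
      conj [ s ] sts       ≈⟨ conj-cong {[ s ]} ∼-refl sts∼s ⟩
      s ∷ s ∷ s ∷ []       ≈⟨ ++-congʳ [ s ] (involutive s) ⟩
      [ s ]                ∎)))
    vs∼xssts : v ++ [ s ] ∼ (x ++ [ s ]) ++ sts
    vs∼xssts = begin
      v ++ [ s ]                        ≈⟨ ++-congʳ [ s ] v∼xt ⟩
      (x ++ t) ++ [ s ]                 ≡⟨ ++-assoc x t [ s ] ⟩
      x ++ (t ++ [ s ])                 ≈⟨ ++-congˡ x (cancelˡ [ s ] [ s ] (involutive s) (t ++ [ s ])) ⟨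
      x ++ (s ∷ s ∷ t ++ [ s ])         ≡⟨ ++-assoc x [ s ] sts ⟨
      (x ++ [ s ]) ++ sts               ∎

  -- Edges are shifted one by one. At an exceptional edge x → xs the remaining path already starts
  -- at xs, and the edge y → ys appended at its end restores the length.
  Path-shift : ∀ s → Shorter y (y ++ [ s ]) → Path x y n → ¬ ¬ Path (x ++ [ s ]) (y ++ [ s ]) n
  Path-shift s y<ys (here x∼y) = pure (here (++-congʳ [ s ] x∼y))
  Path-shift s y<ys (step e path) = do
    no v≁xs ← ¬¬-excluded-middle
      where yes v∼xs → pure (Path-∷ʳ (Path-resp v∼xs ∼-refl path) (⟶-·s y<ys))
    xs⟶vs ← ⟶-shift s e v≁xs
    path′ ← Path-shift s y<ys path
    pure (step xs⟶vs path′)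

  -- Lower bound in the recursion for a(u,w), used with y = w and ys = ws. At an exceptional edge x
  -- → v = xs one has vs = x, so the two alternatives for the rest of the path trade places.
  Path-lift : ∀ s → Path x y n →
              ¬ ¬ ((∃[ k ] (k ≤ n × Path (x ++ [ s ]) (y ++ [ s ]) k)) ⊎ (∃[ k ] (k < n × Path x (y ++ [ s ]) k)))
  Path-lift s (here x∼y) = pure (inj₁ (0 , z≤n , here (++-congʳ [ s ] x∼y)))
  Path-lift {x = x} s (step e path) = do
    no v≁xs ← ¬¬-excluded-middle
      where yes v∼xs → do
              inj₁ (k , k≤n , path′) ← Path-lift s path
                where inj₂ (k , k<n , path′) → pure (inj₁ (k , ℕ.m≤n⇒m≤1+n (<⇒≤ k<n) , Path-resp v∼xs ∼-refl path′))
              pure (inj₂ (k , s≤s k≤n , Path-resp (∼-trans (++-congʳ [ s ] v∼xs) (·s·s x s)) ∼-refl path′))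
    inj₁ (k , k≤n , path′) ← Path-lift s path
      where inj₂ (k , k<n , path′) → pure (inj₂ (suc k , s≤s k<n , step e path′))
    xs⟶vs ← ⟶-shift s e v≁xs
    pure (inj₁ (suc k , s≤s k≤n , step xs⟶vs path′))

  -- The support of R

  module _ {R : Word → Word → Poly} (isR : IsRFamily R) where

    open IsRFamily isR

    coef : Word → Word → ℕ → ℤ
    coef u w k = coefQ1 k (R u w)

    -- a(u,w) ≤ k is expressed by a path with at most k edges, so no minimum need be exhibited and
    -- pairs with u ≰ w are included. The upper bound is additive to avoid truncated subtraction.
    record Support (u w : Word) (lu lw : ℕ) : Set where
      field
        positive   : ∀ n k → Path u w n → n ≤ k → k + lu ≤ lw → 0ℤ ℤ.< coef u w k
        zero-below : ∀ k → (∀ n → n ≤ k → ¬ Path u w n) → coef u w k ≡ 0ℤ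
        zero-above : ∀ k → lw < k + lu → coef u w k ≡ 0ℤ

      nonnegative : ∀ k → 0ℤ ℤ.≤ coef u w k
      nonnegative k = decidable-stable (0ℤ ℤ.≤? coef u w k) do
        yes (n , n≤k , path) ← ¬¬-excluded-middle {A = ∃[ n ] (n ≤ k × Path u w n)}
          where no ∄path → pure (ℤ.≤-reflexive (sym (zero-below k λ n n≤k path → ∄path (n , n≤k , path))))
        pure (from-path path n≤k)
        where
        from-path : Path u w n → n ≤ k → 0ℤ ℤ.≤ coef u w k
        from-path path n≤k with k + lu ≤? lw
        ... | yes k+lu≤lw = ℤ.<⇒≤ (positive _ k path n≤k k+lu≤lw)
        ... | no  k+lu≰lw = ℤ.≤-reflexive (sym (zero-above k (≰⇒> k+lu≰lw)))

    open Support

    -- Every field concludes with a decidable statement about integers, so stability holds field by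
    -- field.
    support-stable : ∀ {lu lw} → ¬ ¬ Support u w lu lw → Support u w lu lw
    support-stable ¬¬S .positive   n k path n≤k k+lu≤lw =
      decidable-stable (_ ℤ.<? _) (¬¬-map (λ S → positive S n k path n≤k k+lu≤lw) ¬¬S)
    support-stable ¬¬S .zero-below k ∄path =
      decidable-stable (_ ℤ.≟ _) (¬¬-map (λ S → zero-below S k ∄path) ¬¬S)
    support-stable ¬¬S .zero-above k lw<k+lu =
      decidable-stable (_ ℤ.≟ _) (¬¬-map (λ S → zero-above S k lw<k+lu) ¬¬S)

    support-identity : IsLength w 0 → ∀ {lu} → IsLength u lu → ¬ ¬ Support u w lu 0
    support-identity {w} {u} ℓw {lu} ℓu = do
      yes u∼w ← ¬¬-excluded-middle
        where no u≁w → let ∄path = λ { (_ , path) → u≁w (Path⇒∼ path) } in pure record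
                { positive   = λ n k path → contradiction (n , path) ∄path
                ; zero-below = λ k _ → coefQ1-cong k (R u w) 0ₚ (vanish u w ∄path)
                ; zero-above = λ k _ → coefQ1-cong k (R u w) 0ₚ (vanish u w ∄path)
                }
      let lu≡0    = IsLength-unique (IsLength-resp u∼w ℓu) ℓw
          coef≡   = λ k → coefQ1-cong k (R u w) 1ₚ (λ i → trans (resp u∼w ∼-refl i) (diag w i))
      pure record
        { positive   = λ { n zero    _ _ _ → subst (0ℤ ℤ.<_) (sym (coef≡ 0)) (ℤ.+<+ (s≤s z≤n))
                         ; n (suc k) _ _ () }
        ; zero-below = λ k ∄path → contradiction (here u∼w) (∄path 0 z≤n)
        ; zero-above = λ { zero    0<lu → contradiction (subst (0 <_) lu≡0 0<lu) λ ()
                         ; (suc k) _    → coef≡ (suc k) }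
        }
      where
      Path⇒∼ : Path u w n → u ∼ w
      Path⇒∼ (here u∼w) = u∼w
      Path⇒∼ path@(step _ _) = contradiction (Path-length path ℓu ℓw) λ ()

    -- Induction step at a right descent s of w.

    module Descent {w : Word} {s : I} {lw : ℕ} (ℓw : IsLength w (suc lw)) (ℓws : IsLength (w ++ [ s ]) lw)
                   (IH : ∀ {u lu} → IsLength u lu → Support u (w ++ [ s ]) lu lw) where

      _·s : Word → Word
      x ·s = x ++ [ s ]

      ws<w : Shorter (w ·s) w
      ws<w = lw , suc lw , ℓws , ℓw , ≤-refl

      ws<wss : Shorter (w ·s) (w ·s ·s)
      ws<wss = Shorter-resp ∼-refl (∼-sym (·s·s w s)) ws<w

      -- The bound a(u,w) ≤ a(us,ws): shift by s once more and cancel ss.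
      unshift : Path (u ·s) (w ·s) n → ¬ ¬ Path u w n
      unshift {u} path = ¬¬-map (Path-resp (·s·s u s) (·s·s w s)) (Path-shift s ws<wss path)

      support-down : ∀ {lu} → IsLength (u ·s) lu → IsLength u (suc lu) → Support u w (suc lu) (suc lw)
      support-down {u} {lu} ℓus ℓu = record
        { positive   = λ n k path n≤k k+lu≤lw → subst (0ℤ ℤ.<_) (sym (coef≡ k))
            (decidable-stable (_ ℤ.<? _) do
              j , j≤n , path′ ← shift path
              pure (positive S j k path′ (≤-trans j≤n n≤k) (s≤s⁻¹ (subst (_≤ suc lw) (+-suc k lu) k+lu≤lw))))
        ; zero-below = λ k ∄path → trans (coef≡ k) (zero-below S k λ n n≤k path → unshift path (∄path n n≤k))
        ; zero-above = λ k lw<k+lu → trans (coef≡ k) (zero-above S k (s≤s⁻¹ (subst (suc lw <_) (+-suc k lu) lw<k+lu)))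
        }
        where
        S : Support (u ·s) (w ·s) lu lw
        S = IH ℓus
        us<u : Shorter (u ·s) u
        us<u = lu , suc lu , ℓus , ℓu , ≤-refl
        coef≡ : ∀ k → coef u w k ≡ coef (u ·s) (w ·s) k
        coef≡ k = coefQ1-cong k (R u w) (R (u ·s) (w ·s)) (rec-down u w s ws<w us<u)
        shift : Path u w n → ¬ ¬ (∃[ k ] (k ≤ n × Path (u ·s) (w ·s) k))
        shift path = do
          inj₂ (k , k<n , path′) ← Path-lift s path
            where inj₁ lifted → pure lifted
          -- A path from u to ws with fewer than n edges has room for the edge us → u in front.
          pure (suc k , k<n , step (⟶-resp ∼-refl (·s·s u s) (⟶-·s (Shorter-resp ∼-refl (∼-sym (·s·s u s)) us<u))) path′)

      support-up : ∀ {lu} → IsLength u lu → IsLength (u ·s) (suc lu) → Support u w lu (suc lw)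
      support-up {u} {lu} ℓu ℓus = record
        { positive   = λ n k path n≤k k+lu≤lw → decidable-stable (_ ℤ.<? _) do
            lifted ← Path-lift s path
            pure (pos k n≤k k+lu≤lw lifted)
        ; zero-below = below
        ; zero-above = above
        }
        where
        A : Support (u ·s) (w ·s) (suc lu) lw
        A = IH ℓus
        B : Support u (w ·s) lu lw
        B = IH ℓu
        α β : ℕ → ℤ
        α k = coef (u ·s) (w ·s) k
        β k = coef u (w ·s) k
        u<us : Shorter u (u ·s)
        u<us = lu , suc lu , ℓu , ℓus , ≤-refl

        f g : Poly
        f = R (u ·s) (w ·s)
        g = R u (w ·s)
        recursion : ∀ k → coef u w k ≡ coefQ1 k ((q· f) ⊕ (q-1· g))
        recursion k = coefQ1-cong k (R u w) ((q· f) ⊕ (q-1· g)) (rec-up u w s ws<w u<us)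

        coef-0 : coef u w 0 ≡ α 0
        coef-0 = trans (recursion 0) (coefQ1-rec-0 f g)

        coef-suc : ∀ k → coef u w (suc k) ≡ (α k ℤ.+ α (suc k)) ℤ.+ β k
        coef-suc k = trans (recursion (suc k)) (coefQ1-rec-suc k f g)

        sum-zero : ∀ k → α k ≡ 0ℤ → α (suc k) ≡ 0ℤ → β k ≡ 0ℤ → coef u w (suc k) ≡ 0ℤ
        sum-zero k α≡0 α′≡0 β≡0 = trans (coef-suc k) (cong₂ ℤ._+_ (cong₂ ℤ._+_ α≡0 α′≡0) β≡0)

        below : ∀ k → (∀ n → n ≤ k → ¬ Path u w n) → coef u w k ≡ 0ℤ
        below zero    ∄path = trans coef-0 (zero-below A 0 λ n n≤k path → unshift path (∄path n n≤k))
        below (suc k) ∄path = sum-zero k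
          (zero-below A k       λ n n≤k path → unshift path (∄path n (ℕ.m≤n⇒m≤1+n n≤k)))
          (zero-below A (suc k) λ n n≤k path → unshift path (∄path n n≤k))
          (zero-below B k       λ n n≤k path → ∄path (suc n) (s≤s n≤k)
            (Path-∷ʳ path (⟶-resp ∼-refl (·s·s w s) (⟶-·s ws<wss))))

        above : ∀ k → suc lw < k + lu → coef u w k ≡ 0ℤ
        above zero    lw<lu   = trans coef-0 (zero-above A 0 (≤-trans (<⇒≤ lw<lu) (ℕ.n≤1+n lu)))
        above (suc k) (s≤s lw<k+lu) = sum-zero k
          (zero-above A k       (≤-trans lw<k+lu (ℕ.+-monoʳ-≤ k (ℕ.n≤1+n lu))))
          (zero-above A (suc k) (≤-trans lw<k+lu (ℕ.+-mono-≤ (ℕ.n≤1+n k) (ℕ.n≤1+n lu))))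
          (zero-above B k lw<k+lu)

        pos : ∀ k → n ≤ k → k + lu ≤ suc lw →
              (∃[ j ] (j ≤ n × Path (u ·s) (w ·s) j)) ⊎ (∃[ j ] (j < n × Path u (w ·s) j)) → 0ℤ ℤ.< coef u w k
        pos zero n≤0 _ (inj₁ (j , j≤n , path)) = subst (0ℤ ℤ.<_) (sym coef-0)
          (positive A j 0 path (≤-trans j≤n n≤0) (≤-trans (ℕ.m≤n+m (suc lu) j) (Path-length path ℓus ℓws)))
        pos zero n≤0 _ (inj₂ (j , j<n , path)) = contradiction (≤-trans j<n n≤0) λ ()
        pos (suc k) n≤k (s≤s k+lu≤lw) lifted = subst (0ℤ ℤ.<_) (sym (coef-suc k)) (sum-pos lifted)
          where
          α≥0 : 0ℤ ℤ.≤ α k ℤ.+ α (suc k)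
          α≥0 = ℤ.+-mono-≤ (nonnegative A k) (nonnegative A (suc k))
          sum-pos : _ → 0ℤ ℤ.< (α k ℤ.+ α (suc k)) ℤ.+ β k
          sum-pos (inj₂ (j , j<n , path)) =
            ℤ.+-mono-≤-< α≥0 (positive B j k path (s≤s⁻¹ (≤-trans j<n n≤k)) k+lu≤lw)
          -- α is supported up to ℓ(w) - ℓ(u) - 2. If k + 1 is within this bound, `α (suc k)` is
          -- positive. If only k is, the path length forces j ≤ k and `α k` is positive. Otherwise j
          -- < k, and putting u → us in front of the path makes `β k` positive.
          sum-pos (inj₁ (j , j≤n , path)) with suc k + suc lu ≤? lw | k + suc lu ≤? lw
          ... | yes k+1≤ | _ = ℤ.+-mono-<-≤ (ℤ.+-mono-≤-< (nonnegative A k)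
                  (positive A j (suc k) path (≤-trans j≤n n≤k) k+1≤)) (nonnegative B k)
          ... | no  k+1≰ | yes k≤ = ℤ.+-mono-<-≤ (ℤ.+-mono-<-≤
                  (positive A j k path (s≤s⁻¹ (ℕ.+-cancelʳ-< (suc lu) j (suc k)
                    (ℕ.≤-<-trans (Path-length path ℓus ℓws) (≰⇒> k+1≰)))) k≤)
                  (nonnegative A (suc k))) (nonnegative B k)
          ... | no  _    | no k≰ = ℤ.+-mono-≤-< α≥0
                  (positive B (suc j) k (step (⟶-·s u<us) path) (ℕ.+-cancelʳ-< (suc lu) j k
                    (ℕ.≤-<-trans (Path-length path ℓus ℓws) (≰⇒> k≰))) k+lu≤lw)

    support : ∀ lw → IsLength w lw → ∀ {u lu} → IsLength u lu → Support u w lu lw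
    support zero     ℓw ℓu = support-stable (support-identity ℓw ℓu)
    support {w} (suc lw) ℓw@((y , y∼w , ∣y∣) , min) {u} {lu} ℓu with initLast y
    -- The last letter of a shortest word for w is a right descent of w.
    ... | y′ ∷ʳ′ s = support-stable do
      inj₁ (lus , _ , ℓus , ℓu′ , lus<lu) ← compare-·s u s
        where inj₂ (_ , lus , ℓu′ , ℓus , lu<lus) → pure (up ℓus (subst (_< lus) (IsLength-unique ℓu′ ℓu) lu<lus))
      pure (down ℓus (subst (lus <_) (IsLength-unique ℓu′ ℓu) lus<lu))
      where
      ws : Word
      ws = w ++ [ s ]
      ∣·s∣ : ∀ z → length (z ++ [ s ]) ≡ suc (length z)
      ∣·s∣ z = trans (length-++ z) (+-comm (length z) 1)
      ℓws : IsLength ws lw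
      ℓws = (y′ , ∼-trans (∼-sym (·s·s y′ s)) (++-congʳ [ s ] y∼w) , ℕ.suc-injective (trans (sym (∣·s∣ y′)) ∣y∣))
          , λ z z∼ws → s≤s⁻¹ (≤-trans (min (z ++ [ s ]) (∼-trans (++-congʳ [ s ] z∼ws) (·s·s w s))) (≤-reflexive (∣·s∣ z)))
      open Descent ℓw ℓws (support lw ℓws)
      up : ∀ {lus} → IsLength (u ++ [ s ]) lus → lu < lus → Support u w lu (suc lw)
      -- A generator changes the length by at most one, so a strict inequality fixes the difference.
      up ℓus lu<lus with ≤-antisym (IsLength-·s s ℓu ℓus) lu<lus
      ... | refl = support-up ℓu ℓus
      down : ∀ {lus} → IsLength (u ++ [ s ]) lus → lus < lu → Support u w lu (suc lw)
      down ℓus lus<lu with ≤-antisym (IsLength-·s s ℓus (IsLength-resp (∼-sym (·s·s u s)) ℓu)) lus<lu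
      ... | refl = support-down ℓus ℓu

-- From the support to absolute length, divisibility and nonnegativity.

theorem1 : (I : Set) (m : I → I → ℕ) → IsCoxeterMatrix m →
    (R : List I → List I → Poly) → Coxeter.IsRFamily m R →
    let open Coxeter m in
    (∀ u w → u <B w → ∀ a lu lw → IsAbsLength u w a → IsLength u lu → IsLength w lw →
    (∀ n → (n < a ⊎ lw ∸ lu < n) → coefQ1 n (R u w) ≡ 0ℤ)
    × (∀ n → a ≤ n → n ≤ lw ∸ lu → 0ℤ <ℤ coefQ1 n (R u w))
    × (Q1Divides a (R u w) × ¬ Q1Divides (suc a) (R u w)))
    × (∀ u w → NonnegQ1 (R u w))
theorem1 I m isCoxeter R isR = interval , nonneg
  where
  open Coxeter m
  open CoxeterSystem isCoxeter

  interval : ∀ u w → u <B w → ∀ a lu lw → IsAbsLength u w a → IsLength u lu → IsLength w lw →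
    (∀ n → (n < a ⊎ lw ∸ lu < n) → coefQ1 n (R u w) ≡ 0ℤ)
    × (∀ n → a ≤ n → n ≤ lw ∸ lu → 0ℤ <ℤ coefQ1 n (R u w))
    × (Q1Divides a (R u w) × ¬ Q1Divides (suc a) (R u w))
  interval u w _ a lu lw (path , shortest) ℓu ℓw =
    (λ { n (inj₁ n<a) → below n n<a
       ; n (inj₂ lw∸lu<n) → zero-above n (≰⇒> λ n+lu≤lw → ℕ.<⇒≱ lw∸lu<n (ℕ.m+n≤o⇒m≤o∸n n n+lu≤lw)) })
    , above
    , coefs-zero⇒Q1Divides a (R u w) below
    -- A shortest path shows a ≤ ℓ(u,w), so the coefficient at a is positive, whereas divisibility
    -- by the next power would make it vanish.
    , λ divides → ℤ.<⇒≢ (above a ≤-refl (ℕ.m+n≤o⇒m≤o∸n a a+lu≤lw))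
                        (sym (Q1Divides⇒coefs-zero (suc a) (R u w) divides a ≤-refl))
    where
    open Support (support isR lw ℓw ℓu)
    a+lu≤lw : a + lu ≤ lw
    a+lu≤lw = Path-length path ℓu ℓw
    below : ∀ n → n < a → coefQ1 n (R u w) ≡ 0ℤ
    below n n<a = zero-below n λ j j≤n path′ → ℕ.<⇒≱ n<a (≤-trans (shortest j path′) j≤n)
    above : ∀ n → a ≤ n → n ≤ lw ∸ lu → 0ℤ <ℤ coefQ1 n (R u w)
    above n a≤n n≤lw∸lu = positive a n path a≤n
      (≤-trans (ℕ.+-monoˡ-≤ lu n≤lw∸lu) (≤-reflexive (ℕ.m∸n+n≡m (ℕ.m+n≤o⇒n≤o a a+lu≤lw))))

  nonneg : ∀ u w → NonnegQ1 (R u w)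
  nonneg u w n = decidable-stable (0ℤ ℤ.≤? coefQ1 n (R u w)) do
    _ , ℓu ← IsLength-total u
    lw , ℓw ← IsLength-total w
    pure (Support.nonnegative (support isR lw ℓw ℓu) n)
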